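{- For a positive integer $n$, let $\mathcal{P}(n)$ be the probability that a graph $\Gamma$ chosen uniformly at random from the $2^{\binom n2}$ labeled simple graphs on $n$ vertices has nontrivial group $\mathrm{Aut}^{\pi}(\Gamma)$. Then $\lim_{n\to\infty}\mathcal{P}(n)=0$.
   Context: $N(v)$ is the neighbourhood of $v$. $\mathrm{Aut}^{\pi}(\Gamma)$ is the group of bijections $\pi$ of the vertex set such that for every vertex $v$ there exists a vertex $w$ with $\pi(N(v))=N(w)$. -}

module Defs where

open import Data.Nat using (ℕ; zero; suc)
open import Data.Bool using (Bool; true; false; _∧_; _∨_; not; if_then_else_)
open import Data.Fin using (Fin)
open import Data.Fin.Properties using (_≟_)
open import Data.Vec using (Vec; []; _∷_; lookup)
open import Data.Bool.ListAction using (all; any)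
open import Data.List using (List; []; _∷_; filterᵇ; length; allFin; map; concatMap)
open import Relation.Nullary.Decidable using (⌊_⌋)

AdjMatrix : ℕ → Set
AdjMatrix n = Vec (Vec Bool n) n

adj : ∀ {n} → AdjMatrix n → Fin n → Fin n → Bool
adj M i j = lookup (lookup M i) j

allVecs : ∀ {A : Set} (m : ℕ) → List A → List (Vec A m)
allVecs zero    xs = [] ∷ []
allVecs (suc m) xs = concatMap (λ x → map (x ∷_) (allVecs m xs)) xs

allMatrices : (n : ℕ) → List (AdjMatrix n)
allMatrices n = allVecs n (allVecs n (true ∷ false ∷ []))

_==ᵇ_ : Bool → Bool → Bool
true  ==ᵇ b = b
false ==ᵇ b = not b

_==ᶠ_ : ∀ {n} → Fin n → Fin n → Bool
i ==ᶠ j = ⌊ i ≟ j ⌋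

isSimple : ∀ {n} → AdjMatrix n → Bool
isSimple {n} M =
  all (λ i → not (adj M i i) ∧ all (λ j → adj M i j ==ᵇ adj M j i) (allFin n)) (allFin n)

simpleGraphs : (n : ℕ) → List (AdjMatrix n)
simpleGraphs n = filterᵇ isSimple (allMatrices n)

Map : ℕ → Set
Map n = Vec (Fin n) n

app : ∀ {n} → Map n → Fin n → Fin n
app f i = lookup f i

isBijection : ∀ {n} → Map n → Bool
isBijection {n} f =
  all (λ i → all (λ j → not (app f i ==ᶠ app f j) ∨ (i ==ᶠ j)) (allFin n)) (allFin n)
  ∧ all (λ y → any (λ x → app f x ==ᶠ y) (allFin n)) (allFin n)

isIdentity : ∀ {n} → Map n → Bool
isIdentity {n} f = all (λ i → app f i ==ᶠ i) (allFin n)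

-- π(N(v)) = N(w): for a bijection π this says x ∈ N(v) ⇔ π x ∈ N(w) for all x
imageNbhdIsNbhd : ∀ {n} → AdjMatrix n → Map n → Fin n → Fin n → Bool
imageNbhdIsNbhd {n} M f v w = all (λ x → adj M v x ==ᵇ adj M w (app f x)) (allFin n)

inAutπ : ∀ {n} → AdjMatrix n → Map n → Bool
inAutπ {n} M f =
  isBijection f ∧ all (λ v → any (λ w → imageNbhdIsNbhd M f v w) (allFin n)) (allFin n)

autπNontrivial : ∀ {n} → AdjMatrix n → Bool
autπNontrivial {n} M = any (λ f → inAutπ M f ∧ not (isIdentity f)) (allVecs n (allFin n))

#nontrivial : ℕ → ℕ
#nontrivial n = length (filterᵇ autπNontrivial (simpleGraphs n))

#graphs : ℕ → ℕ
#graphs n = length (simpleGraphs n)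

module Submission where

-- If π maps neighbourhoods to neighbourhoods, choosing σ v with
-- π(N(v)) = N(σ v) gives a function σ with M v x = M (σ v) (π x) for all v, x.
-- Greedily choose vertices v₁, …, v_k moved by σ, each distinct from all
-- earlier v_i and σ v_i.
--   If this succeeds, row v_i can be read off row σ v_i, so the entries joining
-- the v_i to the n − 2k remaining vertices are redundant.  There are at most
-- n^(2n) pairs (σ, π), each with probability at most 2^(−k(n−2k)).
--   If it gets stuck, σ fixes every vertex outside a set C of 2k vertices, and
-- a vertex x moved by π has the same neighbours as π x outside C.  There are
-- n^(2+2k) choices of (x, π x, C), each with probability at most 2^(−(n−2−2k)).
-- With n ≤ 2^ℓ and k = 3ℓ both union bounds tend to 0.

open import Defs
open import Data.Bool using (Bool; true; false; _∧_; _∨_; not; if_then_else_; T) renaming (_≟_ to _≟ᵇ_)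
open import Data.Bool.ListAction using (all; any)
open import Data.Bool.Properties using (T-∧; T-∨; T-≡; T-not-≡; not-¬; not-injective)
open import Data.Empty using (⊥-elim)
open import Data.Fin using (Fin; fromℕ<)
open import Data.Fin.Properties using (_≟_; any?; all?; injective⇒≤; ¬∀⟶∃¬)
open import Data.List using (List; []; _∷_; _++_; filter; filterᵇ; length; allFin; map; concatMap; cartesianProduct)
open import Data.List.Membership.Propositional using (_∈_; _∉_)
open import Data.List.Membership.Propositional.Properties
  using (∈-allFin; ∈-filter⁺; ∈-filter⁻; ∈-map⁺; ∈-concatMap⁺; ∈-cartesianProduct⁻; ∈-++⁺ˡ; ∈-++⁺ʳ)
open import Data.List.Properties using (length-map; length-++; length-tabulate)
open import Data.List.Relation.Unary.All as All using (All; []; _∷_)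
open import Data.List.Relation.Unary.All.Properties using (all⁺; all⁻; ¬Any⇒All¬; All¬⇒¬Any)
open import Data.List.Relation.Unary.Any as Any using (here; there; index)
open import Data.List.Relation.Unary.Any.Properties using (any⁺; any⁻; lookup-index)
open import Data.List.Relation.Unary.AllPairs using ([]; _∷_)
open import Data.List.Relation.Unary.Unique.Propositional using (Unique)
open import Data.List.Relation.Unary.Unique.Propositional.Properties using (filter⁺; allFin⁺; cartesianProduct⁺)
open import Data.Nat using (ℕ; zero; suc; _+_; _*_; _∸_; _^_; _≤_; _<_; z≤n; s≤s; >-nonZero; _≤?_)
open import Data.Nat.ListAction using (sum)
open import Data.Nat.Properties hiding (_≟_)
open import Data.Nat.Solver using (module +-*-Solver)
open import Data.Product using (∃; _×_; _,_; proj₁; proj₂; swap; uncurry)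
open import Data.Product.Properties using (≡-dec)
open import Data.Sum using (_⊎_; inj₁; inj₂; [_,_]′)
open import Data.Vec using (Vec; []; _∷_; lookup; updateAt; tabulate; toList; replicate)
open import Data.Vec.Properties using (lookup∘updateAt; lookup∘updateAt′; lookup∘tabulate; length-toList; lookup-replicate)
open import Function using (_∘_; Equivalence)
open import Relation.Binary using (DecidableEquality)
open import Relation.Binary.PropositionalEquality
open import Relation.Nullary using (¬_; Dec; yes; no; contradiction)
open import Relation.Nullary.Decidable using (⌊_⌋; toWitness; fromWitness; _×-dec_; _⊎-dec_; ¬?; T?)

open Equivalence using (to; from)

private
  variable
    A B : Set

-- Sums and counts over lists

∑ : List A → (A → ℕ) → ℕ
∑ xs f = sum (map f xs)

bit : Bool → ℕ
bit b = if b then 1 else 0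

count : (A → Bool) → List A → ℕ
count P xs = ∑ xs (bit ∘ P)

∑-cong : ∀ (xs : List A) {f g : A → ℕ} → (∀ x → f x ≡ g x) → ∑ xs f ≡ ∑ xs g
∑-cong []       eq = refl
∑-cong (x ∷ xs) eq = cong₂ _+_ (eq x) (∑-cong xs eq)

∑-mono : ∀ (xs : List A) {f g : A → ℕ} → (∀ x → f x ≤ g x) → ∑ xs f ≤ ∑ xs g
∑-mono []       le = z≤n
∑-mono (x ∷ xs) le = +-mono-≤ (le x) (∑-mono xs le)

∑-+ : ∀ (xs : List A) (f g : A → ℕ) → ∑ xs (λ x → f x + g x) ≡ ∑ xs f + ∑ xs g
∑-+ []       f g = refl
∑-+ (x ∷ xs) f g = begin
  (f x + g x) + ∑ xs (λ x → f x + g x) ≡⟨ cong (f x + g x +_) (∑-+ xs f g) ⟩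
  (f x + g x) + (∑ xs f + ∑ xs g)      ≡⟨ solve 4 (λ a b c d → (a :+ b) :+ (c :+ d) := (a :+ c) :+ (b :+ d)) refl (f x) (g x) (∑ xs f) (∑ xs g) ⟩
  (f x + ∑ xs f) + (g x + ∑ xs g)      ∎
  where
  open ≡-Reasoning
  open +-*-Solver

∑-map : ∀ (g : A → B) xs (f : B → ℕ) → ∑ (map g xs) f ≡ ∑ xs (f ∘ g)
∑-map g []       f = refl
∑-map g (x ∷ xs) f = cong (f (g x) +_) (∑-map g xs f)

∑-++ : ∀ (xs ys : List A) f → ∑ (xs ++ ys) f ≡ ∑ xs f + ∑ ys f
∑-++ []       ys f = refl
∑-++ (x ∷ xs) ys f = trans (cong (f x +_) (∑-++ xs ys f)) (sym (+-assoc (f x) _ _))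

∑-concatMap : ∀ (g : A → List B) xs f → ∑ (concatMap g xs) f ≡ ∑ xs (λ x → ∑ (g x) f)
∑-concatMap g []       f = refl
∑-concatMap g (x ∷ xs) f =
  trans (∑-++ (g x) (concatMap g xs) f) (cong (∑ (g x) f +_) (∑-concatMap g xs f))

∑-const : ∀ (xs : List A) c → ∑ xs (λ _ → c) ≡ length xs * c
∑-const []       c = refl
∑-const (x ∷ xs) c = cong (c +_) (∑-const xs c)

length≡∑1 : (xs : List A) → length xs ≡ ∑ xs (λ _ → 1)
length≡∑1 xs = trans (sym (*-identityʳ _)) (sym (∑-const xs 1))

length-filterᵇ : ∀ (P : A → Bool) xs → length (filterᵇ P xs) ≡ count P xs
length-filterᵇ P [] = refl
length-filterᵇ P (x ∷ xs) with P x
... | true  = cong suc (length-filterᵇ P xs)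
... | false = length-filterᵇ P xs

count-filterᵇ : ∀ (P Q : A → Bool) xs → count P (filterᵇ Q xs) ≡ count (λ x → Q x ∧ P x) xs
count-filterᵇ P Q [] = refl
count-filterᵇ P Q (x ∷ xs) with Q x
... | true  = cong (bit (P x) +_) (count-filterᵇ P Q xs)
... | false = count-filterᵇ P Q xs

bit-mono : ∀ {a b} → (T a → T b) → bit a ≤ bit b
bit-mono {false} imp = z≤n
bit-mono {true} {true}  imp = ≤-refl
bit-mono {true} {false} imp = ⊥-elim (imp _)

count-mono : ∀ {P Q : A → Bool} xs → (∀ x → T (P x) → T (Q x)) → count P xs ≤ count Q xs
count-mono xs imp = ∑-mono xs (λ x → bit-mono (imp x))

count-∨ : ∀ (P Q : A → Bool) xs → count (λ x → P x ∨ Q x) xs ≤ count P xs + count Q xs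
count-∨ P Q xs = ≤-trans (∑-mono xs (λ x → bit-∨ (P x) (Q x))) (≤-reflexive (∑-+ xs _ _))
  where
  bit-∨ : ∀ a b → bit (a ∨ b) ≤ bit a + bit b
  bit-∨ true  b = s≤s z≤n
  bit-∨ false b = ≤-refl

count-⊎ : ∀ (P Q : A → Bool) xs → (∀ x → T (P x) → ¬ T (Q x)) →
          count P xs + count Q xs ≡ count (λ x → P x ∨ Q x) xs
count-⊎ P Q xs disj = sym (trans (∑-cong xs (λ x → bit-⊎ (P x) (Q x) (disj x))) (∑-+ xs _ _))
  where
  bit-⊎ : ∀ a b → (T a → ¬ T b) → bit (a ∨ b) ≡ bit a + bit b
  bit-⊎ true  true  d = ⊥-elim (d _ _)
  bit-⊎ true  false d = refl
  bit-⊎ false b     d = refl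

count-none : ∀ {P : A → Bool} xs → (∀ x → ¬ T (P x)) → count P xs ≡ 0
count-none [] none = refl
count-none {P = P} (x ∷ xs) none with P x in eq
... | true  = ⊥-elim (none x (from T-≡ eq))
... | false = count-none xs none

count-pos : ∀ {P : A → Bool} {x xs} → x ∈ xs → T (P x) → 0 < count P xs
count-pos {P = P} {x} (here refl) px with P x
... | true = s≤s z≤n
count-pos {P = P} {x} (there {x = y} x∈) px = ≤-trans (count-pos x∈ px) (m≤n+m _ (bit (P y)))

-- Denominators are cleared: with `S` the number of graphs, `c * count (ev l) xs ≤ S` says that the
-- event of label `l` has probability at most 1/c.
union-bound : ∀ c S (L : List B) (ev : B → A → Bool) xs → (∀ l → c * count (ev l) xs ≤ S) →
              c * count (λ x → any (λ l → ev l x) L) xs ≤ length L * S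
union-bound c S [] ev xs h =
  ≤-reflexive (trans (cong (c *_) (count-none {P = λ _ → false} xs (λ _ ()))) (*-zeroʳ c))
union-bound c S (l ∷ L) ev xs h = begin
  c * count (λ x → ev l x ∨ E x) xs       ≤⟨ *-monoʳ-≤ c (count-∨ (ev l) E xs) ⟩
  c * (count (ev l) xs + count E xs)      ≡⟨ *-distribˡ-+ c _ _ ⟩
  c * count (ev l) xs + c * count E xs    ≤⟨ +-mono-≤ (h l) (union-bound c S L ev xs h) ⟩
  S + length L * S                        ∎
  where
  open ≤-Reasoning
  E = λ x → any (λ l → ev l x) L

-- The hypothesis has the same form as the conclusion, so the lemma feeds itself: it is applied to
-- one bit of a row and then to one row of a matrix.
∑-allVecs-updateAt : ∀ (xs : List A) (g : A → A) → (∀ h → ∑ xs (h ∘ g) ≡ ∑ xs h) →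
  ∀ {m} (i : Fin m) f → ∑ (allVecs m xs) (λ v → f (updateAt v i g)) ≡ ∑ (allVecs m xs) f
∑-allVecs-updateAt xs g inv {suc m} i f =
  trans (unfold _) (trans (step i) (sym (unfold f)))
  where
  unfold : ∀ f → ∑ (allVecs (suc m) xs) f ≡ ∑ xs (λ x → ∑ (allVecs m xs) (λ v → f (x ∷ v)))
  unfold f = trans (∑-concatMap _ xs f) (∑-cong xs (λ x → ∑-map (x ∷_) (allVecs m xs) f))
  step : ∀ i → ∑ xs (λ x → ∑ (allVecs m xs) (λ v → f (updateAt (x ∷ v) i g)))
             ≡ ∑ xs (λ x → ∑ (allVecs m xs) (λ v → f (x ∷ v)))
  step Fin.zero    = inv (λ x → ∑ (allVecs m xs) (λ v → f (x ∷ v)))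
  step (Fin.suc i) = ∑-cong xs (λ x → ∑-allVecs-updateAt xs g inv i (λ v → f (x ∷ v)))

length-allVecs : ∀ (xs : List A) m → length (allVecs m xs) ≡ length xs ^ m
length-allVecs xs zero    = refl
length-allVecs xs (suc m) = begin
  length (allVecs (suc m) xs)                                   ≡⟨ length≡∑1 (allVecs (suc m) xs) ⟩
  ∑ (allVecs (suc m) xs) (λ _ → 1)                              ≡⟨ ∑-concatMap _ xs _ ⟩
  ∑ xs (λ x → ∑ (map (x ∷_) (allVecs m xs)) (λ _ → 1))          ≡⟨ ∑-cong xs (λ x → ∑-map (x ∷_) (allVecs m xs) _) ⟩
  ∑ xs (λ _ → ∑ (allVecs m xs) (λ _ → 1))                       ≡⟨ ∑-const xs _ ⟩
  length xs * ∑ (allVecs m xs) (λ _ → 1)                        ≡⟨ cong (length xs *_) (length≡∑1 (allVecs m xs)) ⟨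
  length xs * length (allVecs m xs)                             ≡⟨ cong (length xs *_) (length-allVecs xs m) ⟩
  length xs * length xs ^ m                                     ∎
  where open ≡-Reasoning

∈-allVecs : ∀ {xs : List A} → (∀ x → x ∈ xs) → ∀ {m} (v : Vec A m) → v ∈ allVecs m xs
∈-allVecs full []      = here refl
∈-allVecs full (x ∷ v) =
  ∈-concatMap⁺ _ (Any.map (λ { refl → ∈-map⁺ _ (∈-allVecs full v) }) (full x))

length-allFin : ∀ n → length (allFin n) ≡ n
length-allFin n = length-tabulate (λ i → i)

all-allFin⁻ : ∀ {n} {p : Fin n → Bool} → T (all p (allFin n)) → ∀ i → T (p i)
all-allFin⁻ {n} {p} h i = All.lookup (all⁺ p (allFin n) h) (∈-allFin i)

all-allFin⁺ : ∀ {n} {p : Fin n → Bool} → (∀ i → T (p i)) → T (all p (allFin n))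
all-allFin⁺ {n} h = all⁻ _ (All.universal h (allFin n))

-- Sending `i` to its position in `ys` is injective, because the entry at that position is `i`
-- again.
covering-length : ∀ {n} (ys : List (Fin n)) → (∀ i → i ∈ ys) → n ≤ length ys
covering-length ys cov = injective⇒≤ {f = λ i → index (cov i)} (λ {i} {j} eq →
  trans (lookup-index (cov i)) (trans (cong (Data.List.lookup ys) eq) (sym (lookup-index (cov j)))))

length-cartesianProduct : ∀ (xs : List A) (ys : List B) →
                          length (cartesianProduct xs ys) ≡ length xs * length ys
length-cartesianProduct []       ys = refl
length-cartesianProduct (x ∷ xs) ys = begin
  length (map (x ,_) ys ++ cartesianProduct xs ys)           ≡⟨ length-++ (map (x ,_) ys) ⟩
  length (map (x ,_) ys) + length (cartesianProduct xs ys)   ≡⟨ cong₂ _+_ (length-map (x ,_) ys) (length-cartesianProduct xs ys) ⟩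
  length ys + length xs * length ys                          ∎
  where open ≡-Reasoning

-- Simple graphs and edge flips

Simple : ∀ {n} → AdjMatrix n → Set
Simple {n} M = (∀ i → adj M i i ≡ false) × (∀ i j → adj M i j ≡ adj M j i)

==ᵇ⇒≡ : ∀ a b → T (a ==ᵇ b) → a ≡ b
==ᵇ⇒≡ true  true  _ = refl
==ᵇ⇒≡ false false _ = refl

≡⇒==ᵇ : ∀ a b → a ≡ b → T (a ==ᵇ b)
≡⇒==ᵇ true  _ refl = _
≡⇒==ᵇ false _ refl = _

isSimple⁻ : ∀ {n} (M : AdjMatrix n) → T (isSimple M) → Simple M
isSimple⁻ M h =
  (λ i → to T-not-≡ (proj₁ (row i))) ,
  (λ i j → ==ᵇ⇒≡ _ _ (all-allFin⁻ (proj₂ (row i)) j))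
  where
  row = λ i → to (T-∧ {not (adj M i i)}) (all-allFin⁻ h i)

isSimple⁺ : ∀ {n} (M : AdjMatrix n) → Simple M → T (isSimple M)
isSimple⁺ M (irr , symm) = all-allFin⁺ (λ i →
  from T-∧ (from T-not-≡ (irr i) , all-allFin⁺ (λ j → ≡⇒==ᵇ _ _ (symm i j))))

module _ {n : ℕ} where

  Pair : Set
  Pair = Fin n × Fin n

  _≟ₚ_ : DecidableEquality Pair
  _≟ₚ_ = ≡-dec _≟_ _≟_

  open import Data.List.Membership.DecPropositional (_≟_ {n}) using (_∈?_)

  entry : AdjMatrix n → Pair → Bool
  entry M (i , j) = adj M i j

  toggle : Pair → AdjMatrix n → AdjMatrix n
  toggle (i , j) M = updateAt M i (λ row → updateAt row j not)

  -- An edge occupies two entries; negating both keeps a symmetric matrix symmetric.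
  flip : Pair → AdjMatrix n → AdjMatrix n
  flip e M = toggle e (toggle (swap e) M)

  toggle-at : ∀ e M → entry (toggle e M) e ≡ not (entry M e)
  toggle-at (i , j) M = trans
    (cong (λ r → lookup r j) (lookup∘updateAt i M))
    (lookup∘updateAt j (lookup M i))

  toggle-off : ∀ e M p → p ≢ e → entry (toggle e M) p ≡ entry M p
  toggle-off (i , j) M (a , b) p≢e with a ≟ i
  ... | no a≢i = cong (λ r → lookup r b) (lookup∘updateAt′ a i a≢i M)
  ... | yes refl = trans
    (cong (λ r → lookup r b) (lookup∘updateAt i M))
    (lookup∘updateAt′ b j (λ { refl → p≢e refl }) (lookup M i))

  module _ (e : Pair) (e≢ : e ≢ swap e) where

    flip-at : ∀ M → entry (flip e M) e ≡ not (entry M e)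
    flip-at M = trans (toggle-at e (toggle (swap e) M)) (cong not (toggle-off (swap e) M e e≢))

    flip-at-swap : ∀ M → entry (flip e M) (swap e) ≡ not (entry M (swap e))
    flip-at-swap M = trans (toggle-off e (toggle (swap e) M) (swap e) (e≢ ∘ sym)) (toggle-at (swap e) M)

    flip-off : ∀ M p → p ≢ e → swap p ≢ e → entry (flip e M) p ≡ entry M p
    flip-off M p p≢ p≢′ =
      trans (toggle-off e (toggle (swap e) M) p p≢) (toggle-off (swap e) M p (λ eq → p≢′ (cong swap eq)))

    flip-cancel : ∀ M M′ → (∀ p → entry (flip e M) p ≡ entry (flip e M′) p) →
                  ∀ p → entry M p ≡ entry M′ p
    flip-cancel M M′ eq p with p ≟ₚ e | swap p ≟ₚ e
    ... | yes refl | _ = not-injective (trans (sym (flip-at M)) (trans (eq e) (flip-at M′)))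
    ... | no _ | yes refl =
      not-injective (trans (sym (flip-at-swap M)) (trans (eq (swap e)) (flip-at-swap M′)))
    ... | no p≢ | no p≢′ =
      trans (sym (flip-off M p p≢ p≢′)) (trans (eq p) (flip-off M′ p p≢ p≢′))

    -- The entries at `e` and `swap e` are both negated, so they agree after the flip exactly if
    -- they agreed before; no diagonal entry changes.
    flip-simple⁻ : ∀ M → Simple (flip e M) → Simple M
    flip-simple⁻ M (irr , symm) =
      (λ i → trans (sym (flip-off M (i , i) (λ { refl → e≢ refl }) (λ { refl → e≢ refl }))) (irr i)) ,
      (λ i j → symm′ (i , j))
      where
      symm-e : entry M e ≡ entry M (swap e)
      symm-e = not-injective (trans (sym (flip-at M)) (trans (uncurry symm e) (flip-at-swap M)))
      symm′ : ∀ p → entry M p ≡ entry M (swap p)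
      symm′ p with p ≟ₚ e | swap p ≟ₚ e
      ... | yes refl | _        = symm-e
      ... | no _     | yes refl = sym symm-e
      ... | no p≢    | no p≢′   =
        trans (sym (flip-off M p p≢ p≢′)) (trans (uncurry symm p) (flip-off M (swap p) p≢′ p≢))

  -- The count runs over all matrices, since a single toggle can leave the simple graphs. Negation
  -- permutes the two bits, hence the rows, hence the matrices.
  count-toggle : ∀ e P → count (P ∘ toggle e) (allMatrices n) ≡ count P (allMatrices n)
  count-toggle (i , j) P =
    ∑-allVecs-updateAt (allVecs n (true ∷ false ∷ [])) _
      (∑-allVecs-updateAt (true ∷ false ∷ []) not bits j) i (bit ∘ P)
    where
    bits : ∀ h → h false + (h true + 0) ≡ h true + (h false + 0)
    bits h = solve 2 (λ a b → b :+ (a :+ con 0) := a :+ (b :+ con 0)) refl (h true) (h false)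
      where open +-*-Solver

  count-flip : ∀ e P → count (P ∘ flip e) (allMatrices n) ≡ count P (allMatrices n)
  count-flip e P = trans (count-toggle (swap e) (P ∘ toggle e)) (count-toggle e P)

  -- Counting graphs determined by part of their entries

  AgreeOff : List Pair → AdjMatrix n → AdjMatrix n → Set
  AgreeOff E M M′ = ∀ p → p ∉ E → swap p ∉ E → entry M p ≡ entry M′ p

  -- Closing P under flips of a pair of E doubles its count and leaves it
  -- determined off the remaining pairs.
  determined-count : ∀ (E : List Pair) → Unique E → (∀ {e} → e ∈ E → swap e ∉ E) →
    ∀ (P : AdjMatrix n → Bool) → (∀ M → T (P M) → Simple M) →
    (∀ M M′ → T (P M) → T (P M′) → AgreeOff E M M′ → ∀ p → entry M p ≡ entry M′ p) →
    2 ^ length E * count P (allMatrices n) ≤ count isSimple (allMatrices n)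
  determined-count [] _ _ P simple det =
    ≤-trans (≤-reflexive (*-identityˡ _)) (count-mono (allMatrices n) (λ M → isSimple⁺ M ∘ simple M))
  determined-count (e ∷ E) (e∉ ∷ uniq) asym P simple det = begin
    2 * 2 ^ length E * c       ≡⟨ solve 2 (λ a b → con 2 :* a :* b := a :* (b :+ b)) refl (2 ^ length E) c ⟩
    2 ^ length E * (c + c)     ≡⟨ cong (2 ^ length E *_) doubled ⟩
    2 ^ length E * count P′ (allMatrices n)
      ≤⟨ determined-count E uniq (λ p∈ → asym (there p∈) ∘ there) P′ simple′ det′ ⟩
    count isSimple (allMatrices n) ∎
    where
    open ≤-Reasoning
    open +-*-Solver
    c = count P (allMatrices n)
    P′ : AdjMatrix n → Bool
    P′ M = P M ∨ P (flip e M)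
    e≢ : e ≢ swap e
    e≢ eq = asym (here refl) (here (sym eq))
    e∉E : e ∉ E
    e∉E = All¬⇒¬Any e∉
    eˢ∉E : swap e ∉ E
    eˢ∉E eˢ∈ = asym (here refl) (there eˢ∈)
    off : ∀ {p} → p ∉ e ∷ E → p ≢ e
    off p∉ = p∉ ∘ here
    -- `M` and `flip e M` agree off `e ∷ E`, so `det` would force equal entries at `e`, where the
    -- flip negates.
    disjoint : ∀ M → T (P M) → ¬ T (P (flip e M))
    disjoint M pm pm′ = not-¬
      (sym (det M (flip e M) pm pm′ (λ p p∉ p∉′ → sym (flip-off e e≢ M p (off p∉) (off p∉′))) e))
      (flip-at e e≢ M)
    doubled : c + c ≡ count P′ (allMatrices n)
    doubled = trans (cong (c +_) (sym (count-flip e P))) (count-⊎ P (P ∘ flip e) (allMatrices n) disjoint)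
    simple′ : ∀ M → T (P′ M) → Simple M
    simple′ M h with to (T-∨ {P M}) h
    ... | inj₁ pm = simple M pm
    ... | inj₂ pf = flip-simple⁻ e e≢ M (simple _ pf)
    -- Agreement off `E` makes `M` and `M′` equal at `e`, while `det` makes `M` and `flip e M′`
    -- equal there. Hence two agreeing graphs satisfy `P′` through the same disjunct.
    mixed : ∀ M M′ → T (P M) → T (P (flip e M′)) → ¬ AgreeOff E M M′
    mixed M M′ pm pf agree = not-¬ (agree e e∉E eˢ∉E)
      (trans (det M (flip e M′) pm pf
                (λ p p∉ p∉′ → trans (agree p (p∉ ∘ there) (p∉′ ∘ there))
                                    (sym (flip-off e e≢ M′ p (off p∉) (off p∉′)))) e)
             (flip-at e e≢ M′))
    det′ : ∀ M M′ → T (P′ M) → T (P′ M′) → AgreeOff E M M′ → ∀ p → entry M p ≡ entry M′ p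
    det′ M M′ h h′ agree with to (T-∨ {P M}) h | to (T-∨ {P M′}) h′
    ... | inj₁ pm | inj₁ pm′ = det M M′ pm pm′ (λ p p∉ p∉′ → agree p (p∉ ∘ there) (p∉′ ∘ there))
    ... | inj₁ pm | inj₂ pf′ = ⊥-elim (mixed M M′ pm pf′ agree)
    ... | inj₂ pf | inj₁ pm′ = ⊥-elim (mixed M′ M pm′ pf (λ p p∉ p∉′ → sym (agree p p∉ p∉′)))
    ... | inj₂ pf | inj₂ pf′ = flip-cancel e e≢ M M′ (det _ _ pf pf′ (λ p p∉ p∉′ →
      trans (flip-off e e≢ M p (off p∉) (off p∉′))
        (trans (agree p (p∉ ∘ there) (p∉′ ∘ there)) (sym (flip-off e e≢ M′ p (off p∉) (off p∉′))))))

  avoiding : (C : List (Fin n)) → List (Fin n)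
  avoiding C = filter (λ i → ¬? (i ∈? C)) (allFin n)

  -- `avoiding C` and `C` together cover all vertices; `C` may have repetitions, so only an
  -- inequality holds.
  avoiding-length : ∀ C → n ∸ length C ≤ length (avoiding C)
  avoiding-length C = ≤-trans (∸-monoˡ-≤ (length C) cover) (≤-reflexive (m+n∸n≡m _ (length C)))
    where
    covered : ∀ i → i ∈ avoiding C ++ C
    covered i with i ∈? C
    ... | yes i∈ = ∈-++⁺ʳ (avoiding C) i∈
    ... | no i∉  = ∈-++⁺ˡ (∈-filter⁺ _ (∈-allFin i) i∉)
    cover : n ≤ length (avoiding C) + length C
    cover = ≤-trans (covering-length _ covered) (≤-reflexive (length-++ (avoiding C)))

  SameRow : AdjMatrix n → AdjMatrix n → Fin n → Set
  SameRow M M′ r = ∀ j → adj M r j ≡ adj M′ r j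

  -- The entries in V × (complement of C) are lost: a graph is recovered from
  -- its other entries, which include all rows in C ∖ V.
  rectangle-count : ∀ (V C : List (Fin n)) → Unique V → (∀ {v} → v ∈ V → v ∈ C) →
    ∀ (P : AdjMatrix n → Bool) → (∀ M → T (P M) → Simple M) →
    (∀ M M′ → T (P M) → T (P M′) → (∀ r → r ∈ C → r ∉ V → SameRow M M′ r) →
      ∀ r → r ∈ V → SameRow M M′ r) →
    2 ^ (length V * (n ∸ length C)) * count P (allMatrices n) ≤ count isSimple (allMatrices n)
  rectangle-count V C uniq V⊆C P simple det = ≤-trans
    (*-monoˡ-≤ (count P (allMatrices n)) (^-monoʳ-≤ 2 size))
    (determined-count E (cartesianProduct⁺ uniq (filter⁺ _ (allFin⁺ n))) asym P simple det′)
    where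
    X = avoiding C
    E = cartesianProduct V X
    size : length V * (n ∸ length C) ≤ length E
    size = ≤-trans (*-monoʳ-≤ (length V) (avoiding-length C)) (≤-reflexive (sym (length-cartesianProduct V X)))
    X∌ : ∀ {i} → i ∈ C → i ∉ X
    X∌ i∈C i∈X = proj₂ (∈-filter⁻ (λ i → ¬? (i ∈? C)) {xs = allFin n} i∈X) i∈C
    inV : ∀ {p} → p ∈ E → proj₁ p ∈ V
    inV p∈ = proj₁ (∈-cartesianProduct⁻ V X p∈)
    inX : ∀ {p} → p ∈ E → proj₂ p ∈ X
    inX p∈ = proj₂ (∈-cartesianProduct⁻ V X p∈)
    -- First coordinates lie in `C` and second coordinates outside it, so no edge is listed in both
    -- orientations.
    asym : ∀ {e} → e ∈ E → swap e ∉ E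
    asym e∈ eˢ∈ = X∌ (V⊆C (inV e∈)) (inX eˢ∈)
    rows : ∀ M M′ → T (P M) → T (P M′) → AgreeOff E M M′ → ∀ r → r ∈ V → SameRow M M′ r
    rows M M′ pm pm′ agree =
      det M M′ pm pm′ (λ r r∈ r∉ j → agree (r , j) (r∉ ∘ inV) (X∌ r∈ ∘ inX))
    det′ : ∀ M M′ → T (P M) → T (P M′) → AgreeOff E M M′ → ∀ p → entry M p ≡ entry M′ p
    det′ M M′ pm pm′ agree (i , j) with i ∈? V | j ∈? V
    ... | no i∉ | no j∉ = agree (i , j) (i∉ ∘ inV) (j∉ ∘ inV)
    ... | yes i∈ | _ = rows M M′ pm pm′ agree i i∈ j
    ... | no _ | yes j∈ =
      trans (proj₂ (simple M pm) i j)
        (trans (rows M M′ pm pm′ agree j j∈ i) (proj₂ (simple M′ pm′) j i))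

  -- Greedy chains of moved vertices

  -- The latest choice comes first. Only `v` has to be new: `f v` may repeat an earlier vertex, so
  -- `C` can have repetitions while `V` cannot. The length `k * 2` is chosen because `suc k * 2`
  -- unfolds to `2 + k * 2`.
  data Chain (f : Fin n → Fin n) : ∀ {k} → Vec (Fin n) k → Vec (Fin n) (k * 2) → Set where
    []     : Chain f [] []
    extend : ∀ {k v} {V : Vec (Fin n) k} {C} → v ≢ f v → v ∉ toList C → Chain f V C →
             Chain f (v ∷ V) (v ∷ f v ∷ C)

  module _ {f : Fin n → Fin n} where

    chain-⊆ : ∀ {k} {V : Vec (Fin n) k} {C} → Chain f V C → ∀ {v} → v ∈ toList V → v ∈ toList C
    chain-⊆ (extend _ _ ch) (here eq)  = here eq
    chain-⊆ (extend _ _ ch) (there v∈) = there (there (chain-⊆ ch v∈))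

    chain-unique : ∀ {k} {V : Vec (Fin n) k} {C} → Chain f V C → Unique (toList V)
    chain-unique []                = []
    chain-unique (extend _ v∉ ch) = ¬Any⇒All¬ _ (v∉ ∘ chain-⊆ ch) ∷ chain-unique ch

    -- The vertices are settled from the earliest choice to the latest. As `f v` is neither `v` nor
    -- a vertex chosen later, it is either an earlier choice, already settled, or an element of `C`
    -- outside `V`, covered by the base case.
    chain-induction : ∀ {k} {V : Vec (Fin n) k} {C} → Chain f V C → (R : Fin n → Set) →
      (∀ v → R (f v) → R v) → (∀ r → r ∈ toList C → r ∉ toList V → R r) →
      ∀ r → r ∈ toList V → R r
    chain-induction {V = v ∷ V} (extend {C = C} v≢fv v∉C ch) R step base = λ
      { r (here refl) → step v Rfv
      ; r (there r∈)  → tail r r∈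
      }
      where
      tail : ∀ r → r ∈ toList V → R r
      tail = chain-induction ch R step (λ r r∈ r∉ → base r (there (there r∈)) (λ
        { (here refl) → v∉C r∈
        ; (there r∈V) → r∉ r∈V
        }))
      Rfv : R (f v)
      Rfv with f v ∈? toList V
      ... | yes fv∈ = tail (f v) fv∈
      ... | no fv∉  = base (f v) (there (here refl)) (λ
        { (here eq)   → v≢fv (sym eq)
        ; (there fv∈) → fv∉ fv∈
        })

  FixedOutside : (Fin n → Fin n) → List (Fin n) → Set
  FixedOutside f C = ∀ v → v ∈ C ⊎ v ≡ f v

  -- The vertex `d` is padding: once the search is stuck, every further round adds two copies of it,
  -- so the exceptional set always becomes a vector of length `k * 2`.
  greedy : Fin n → ∀ k (f : Fin n → Fin n) →
           (∃ λ V → ∃ λ C → Chain f {k} V C) ⊎ (∃ λ (C : Vec (Fin n) (k * 2)) → FixedOutside f (toList C))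
  greedy d zero    f = inj₁ ([] , [] , [])
  greedy d (suc k) f with greedy d k f
  ... | inj₂ (C , fixed) = inj₂ (d ∷ d ∷ C , λ v → [ inj₁ ∘ there ∘ there , inj₂ ]′ (fixed v))
  ... | inj₁ (V , C , ch) with any? (λ v → ¬? (v ≟ f v) ×-dec ¬? (v ∈? toList C))
  ...   | yes (v , v≢ , v∉) = inj₁ (v ∷ V , v ∷ f v ∷ C , extend v≢ v∉ ch)
  ...   | no none = inj₂ (d ∷ d ∷ C , fixed)
    where
    fixed : FixedOutside f (toList (d ∷ d ∷ C))
    fixed v with v ∈? toList C | v ≟ f v
    ... | yes v∈ | _      = inj₁ (there (there v∈))
    ... | no _   | yes eq = inj₂ eq
    ... | no v∉  | no v≢  = contradiction (v , v≢ , v∉) none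

  -- Vertices with equal neighbourhoods outside a small set

  -- The label packs `x`, its image `y` under π and the exceptional set `B` into one vector, so that
  -- `allVecs` enumerates all labels.
  Twins : ∀ {m} → Vec (Fin n) (2 + m) → AdjMatrix n → Set
  Twins (x ∷ y ∷ B) M = T (isSimple M) × x ≢ y × (∀ v → v ∈ toList B ⊎ adj M v x ≡ adj M v y)

  twins? : ∀ {m} (l : Vec (Fin n) (2 + m)) M → Dec (Twins l M)
  twins? (x ∷ y ∷ B) M = T? (isSimple M) ×-dec ¬? (x ≟ y) ×-dec
    all? (λ v → (v ∈? toList B) ⊎-dec (adj M v x ≟ᵇ adj M v y))

  -- Only row `x` loses entries. Outside `B` it is a copy of row `y`, and its entries in a column of
  -- `B` are found, by symmetry, in the row of that vertex.
  twins-count : ∀ {m} (l : Vec (Fin n) (2 + m)) →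
    2 ^ (n ∸ (2 + m)) * count (λ M → ⌊ twins? l M ⌋) (allMatrices n) ≤ count isSimple (allMatrices n)
  twins-count {m} l@(x ∷ y ∷ B) = subst
    (λ e → 2 ^ e * count (λ M → ⌊ twins? l M ⌋) (allMatrices n) ≤ count isSimple (allMatrices n))
    (trans (*-identityˡ _) (cong (λ c → n ∸ (2 + c)) (length-toList B)))
    (rectangle-count (x ∷ []) (toList l) ([] ∷ []) (λ { (here eq) → here eq }) _
      (λ M h → isSimple⁻ M (proj₁ (toWitness h))) det)
    where
    det : ∀ M M′ → T ⌊ twins? l M ⌋ → T ⌊ twins? l M′ ⌋ →
      (∀ r → r ∈ toList l → r ∉ x ∷ [] → SameRow M M′ r) → ∀ r → r ∈ x ∷ [] → SameRow M M′ r
    det M M′ h h′ rows _ (here refl) j = cell (proj₂ (proj₂ tw) j) (proj₂ (proj₂ tw′) j)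
      where
      tw = toWitness {a? = twins? l M} h
      tw′ = toWitness {a? = twins? l M′} h′
      sM = isSimple⁻ M (proj₁ tw)
      sM′ = isSimple⁻ M′ (proj₁ tw′)
      x≢y = proj₁ (proj₂ tw)
      through-row : ∀ r → adj M r j ≡ adj M′ r j → adj M j r ≡ adj M′ j r
      through-row r eq = trans (proj₂ sM j r) (trans eq (proj₂ sM′ r j))
      inB : j ∈ toList B → adj M x j ≡ adj M′ x j
      inB j∈ with j ≟ x
      ... | yes refl = trans (proj₁ sM j) (sym (proj₁ sM′ j))
      ... | no j≢x   = trans (proj₂ sM x j)
        (trans (rows j (there (there j∈)) (λ { (here eq) → j≢x eq }) x) (proj₂ sM′ j x))
      cell : j ∈ toList B ⊎ adj M j x ≡ adj M j y → j ∈ toList B ⊎ adj M′ j x ≡ adj M′ j y →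
             adj M x j ≡ adj M′ x j
      cell (inj₁ j∈) _         = inB j∈
      cell (inj₂ _)  (inj₁ j∈) = inB j∈
      cell (inj₂ eq) (inj₂ eq′) = begin
        adj M x j   ≡⟨ proj₂ sM x j ⟩
        adj M j x   ≡⟨ eq ⟩
        adj M j y   ≡⟨ through-row y (rows y (there (here refl)) (λ { (here y≡x) → x≢y (sym y≡x) }) j) ⟩
        adj M′ j y  ≡⟨ eq′ ⟨
        adj M′ j x  ≡⟨ proj₂ sM′ j x ⟩
        adj M′ x j  ∎
        where open ≡-Reasoning

  -- Pairs (σ, π) with a long chain, and the case distinction

  Invariant : (f g : Fin n → Fin n) → AdjMatrix n → Set
  Invariant f g M = ∀ v x → adj M v x ≡ adj M (f v) (g x)

  module _ (d : Fin n) (k : ℕ) where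

    hasChain : (Fin n → Fin n) → Bool
    hasChain f = [ (λ _ → true) , (λ _ → false) ]′ (greedy d k f)

    -- Whether the search succeeds depends on `σ` alone. Making success part of the event leaves it
    -- empty for every `σ` without a chain.
    Moved : Vec (Map n) 2 → AdjMatrix n → Set
    Moved (σ ∷ π ∷ []) M = T (isSimple M) × T (hasChain (app σ)) × Invariant (app σ) (app π) M

    moved? : ∀ l M → Dec (Moved l M)
    moved? (σ ∷ π ∷ []) M = T? (isSimple M) ×-dec T? (hasChain (app σ)) ×-dec
      all? (λ v → all? (λ x → adj M v x ≟ᵇ adj M (app σ v) (app π x)))

    -- The chain is the same for all graphs of the event. Invariance reads row `v` off row `σ v`
    -- with columns permuted by `π`, so `chain-induction` carries agreement of two graphs from the
    -- rows of `C` outside `V` to those of `V`.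
    moved-count : ∀ l →
      2 ^ (k * (n ∸ k * 2)) * count (λ M → ⌊ moved? l M ⌋) (allMatrices n) ≤ count isSimple (allMatrices n)
    moved-count l@(σ ∷ π ∷ []) = bound (greedy d k (app σ)) refl
      where
      Goal = 2 ^ (k * (n ∸ k * 2)) * count (λ M → ⌊ moved? l M ⌋) (allMatrices n) ≤ count isSimple (allMatrices n)
      bound : ∀ r → greedy d k (app σ) ≡ r → Goal
      bound (inj₂ _) eq = ≤-trans (≤-reflexive (trans (cong (2 ^ (k * (n ∸ k * 2)) *_) none) (*-zeroʳ (2 ^ (k * (n ∸ k * 2)))))) z≤n
        where
        none : count (λ M → ⌊ moved? l M ⌋) (allMatrices n) ≡ 0
        none = count-none (allMatrices n) (λ M h →
          subst (T ∘ [ (λ _ → true) , (λ _ → false) ]′) eq (proj₁ (proj₂ (toWitness {a? = moved? l M} h))))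
      bound (inj₁ (V , C , ch)) _ = subst₂
        (λ a b → 2 ^ (a * (n ∸ b)) * count (λ M → ⌊ moved? l M ⌋) (allMatrices n) ≤ count isSimple (allMatrices n))
        (length-toList V) (length-toList C)
        (rectangle-count (toList V) (toList C) (chain-unique ch) (chain-⊆ ch) _
          (λ M h → isSimple⁻ M (proj₁ (toWitness {a? = moved? l M} h)))
          (λ M M′ h h′ rows → chain-induction ch (SameRow M M′)
            (λ v same j → trans (proj₂ (proj₂ (toWitness {a? = moved? l M} h)) v j)
              (trans (same (app π j)) (sym (proj₂ (proj₂ (toWitness {a? = moved? l M′} h′)) v j))))
            rows))

    -- A nontrivial π supplies σ and a vertex `x` with π x ≠ x; the outcome of the greedy search for
    -- σ decides which event occurs.
    bad⇒events : ∀ M → T (isSimple M ∧ autπNontrivial M) →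
      T (any (λ l → ⌊ twins? l M ⌋) (allVecs (2 + k * 2) (allFin n)) ∨
         any (λ l → ⌊ moved? l M ⌋) (allVecs 2 (allVecs n (allFin n))))
    bad⇒events M h with to (T-∧ {isSimple M}) h
    ... | simple , nontrivial
      with Any.satisfied (any⁻ _ (allVecs n (allFin n)) nontrivial)
    ... | π , hπ with to (T-∧ {inAutπ M π}) hπ
    ... | inAut , notId
      with ¬∀⟶∃¬ n _ (λ x → app π x ≟ x) (λ fixed → T-not (all-allFin⁺ (λ x → fromWitness (fixed x))) notId)
      where
      T-not : ∀ {b} → T b → ¬ T (not b)
      T-not {true} _ ()
    ... | x , πx≢x = from T-∨ (cases (greedy d k (app σ)) refl)
      where
      image : ∀ v → ∃ λ w → T (imageNbhdIsNbhd M π v w)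
      image v = Any.satisfied (any⁻ _ (allFin n) (all-allFin⁻ (proj₂ (to (T-∧ {isBijection π}) inAut)) v))
      -- Several `w` may serve for one `v`. Tabulating a choice makes `σ` a vector, hence one of the
      -- enumerated labels.
      σ : Map n
      σ = tabulate (proj₁ ∘ image)
      invariant : Invariant (app σ) (app π) M
      invariant v y = trans (==ᵇ⇒≡ _ _ (all-allFin⁻ (proj₂ (image v)) y))
        (cong (λ w → adj M w (app π y)) (sym (lookup∘tabulate (proj₁ ∘ image) v)))
      label : ∀ {A : Set} {p : A → Bool} {xs l} → l ∈ xs → T (p l) → T (any p xs)
      label l∈ pl = any⁺ _ (Any.map (λ { refl → pl }) l∈)
      cases : ∀ r → greedy d k (app σ) ≡ r →
        T (any (λ l → ⌊ twins? l M ⌋) (allVecs (2 + k * 2) (allFin n))) ⊎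
        T (any (λ l → ⌊ moved? l M ⌋) (allVecs 2 (allVecs n (allFin n))))
      cases (inj₁ _) eq = inj₂ (label (∈-allVecs (∈-allVecs ∈-allFin) (σ ∷ π ∷ []))
        (fromWitness {a? = moved? (σ ∷ π ∷ []) M}
          (simple , subst (T ∘ [ (λ _ → true) , (λ _ → false) ]′) (sym eq) _ , invariant)))
      cases (inj₂ (C , fixed)) _ = inj₁ (label (∈-allVecs ∈-allFin (x ∷ app π x ∷ C))
        (fromWitness {a? = twins? (x ∷ app π x ∷ C) M} (simple , πx≢x ∘ sym , twin)))
        where
        -- Where σ fixes `v`, invariance compares the entries at `x` and π x within the single row
        -- `v`.
        twin : ∀ v → v ∈ toList C ⊎ adj M v x ≡ adj M v (app π x)
        twin v with fixed v
        ... | inj₁ v∈ = inj₁ v∈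
        ... | inj₂ eq = inj₂ (trans (invariant v x) (cong (λ w → adj M w (app π x)) (sym eq)))

  #graphs≡ : #graphs n ≡ count isSimple (allMatrices n)
  #graphs≡ = length-filterᵇ isSimple (allMatrices n)

  #nontrivial≡ : #nontrivial n ≡ count (λ M → isSimple M ∧ autπNontrivial M) (allMatrices n)
  #nontrivial≡ = trans (length-filterᵇ autπNontrivial (simpleGraphs n)) (count-filterᵇ autπNontrivial isSimple (allMatrices n))

  #graphs>0 : 0 < #graphs n
  #graphs>0 = subst (0 <_) (sym #graphs≡)
    (count-pos {x = ∅} (∈-allVecs (∈-allVecs bit∈) ∅)
      (isSimple⁺ ∅ ((λ i → ∅-entry i i) , λ i j → trans (∅-entry i j) (sym (∅-entry j i)))))
    where
    bit∈ : ∀ b → b ∈ true ∷ false ∷ []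
    bit∈ true  = here refl
    bit∈ false = there (here refl)
    ∅ : AdjMatrix n
    ∅ = replicate n (replicate n false)
    ∅-entry : ∀ i j → adj ∅ i j ≡ false
    ∅-entry i j = trans (cong (λ r → lookup r j) (lookup-replicate i (replicate n false))) (lookup-replicate j false)

-- The two union bounds

-- Here `2 ^ h` bounds the number of labels and `2 ^ g` is the reciprocal of the bound for one
-- event; the surplus `t` of the exponents survives.
cancel-2^ : ∀ t h g {c S} → t + h ≤ g → 2 ^ g * c ≤ 2 ^ h * S → 2 ^ t * c ≤ S
cancel-2^ t h g {c} {S} th≤g le = *-cancelˡ-≤ (2 ^ h) {{m^n≢0 2 h}} (begin
  2 ^ h * (2 ^ t * c) ≡⟨ solve 3 (λ a b c → a :* (b :* c) := b :* a :* c) refl (2 ^ h) (2 ^ t) c ⟩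
  2 ^ t * 2 ^ h * c   ≡⟨ cong (_* c) (^-distribˡ-+-* 2 t h) ⟨
  2 ^ (t + h) * c     ≤⟨ *-monoˡ-≤ c (^-monoʳ-≤ 2 th≤g) ⟩
  2 ^ g * c           ≤⟨ le ⟩
  2 ^ h * S           ∎)
  where
  open ≤-Reasoning
  open +-*-Solver

-- The factor 2 on the right comes from adding two union bounds. The twin bound needs
-- `t + 6ℓ² + 8ℓ + 2 ≤ n` and the chain bound `t + 18ℓ ≤ n`; for `ℓ ≥ 1` the term `18ℓ²` covers
-- both.
nontrivial-bound : ∀ t ℓ {n} → Fin n → 1 ≤ ℓ → n ≤ 2 ^ ℓ → t + 18 * (ℓ * ℓ) ≤ n →
                   2 ^ t * #nontrivial n ≤ 2 * #graphs n
nontrivial-bound t ℓ {n} d 1≤ℓ n≤2^ℓ big =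
  subst₂ (λ b s → 2 ^ t * b ≤ 2 * s) (sym (#nontrivial≡ {n})) (sym (#graphs≡ {n})) (begin
    2 ^ t * count (λ M → isSimple M ∧ autπNontrivial M) (allMatrices n)
      ≤⟨ *-monoʳ-≤ (2 ^ t) (count-mono (allMatrices n) (bad⇒events d k)) ⟩
    2 ^ t * count (λ M → twinned M ∨ moved M) (allMatrices n)
      ≤⟨ *-monoʳ-≤ (2 ^ t) (count-∨ twinned moved (allMatrices n)) ⟩
    2 ^ t * (count twinned (allMatrices n) + count moved (allMatrices n))
      ≡⟨ *-distribˡ-+ (2 ^ t) _ _ ⟩
    2 ^ t * count twinned (allMatrices n) + 2 ^ t * count moved (allMatrices n)
      ≤⟨ +-mono-≤ twinned-bound (≤-trans moved-bound (≤-reflexive (sym (+-identityʳ S)))) ⟩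
    2 * S ∎)
  where
  open ≤-Reasoning
  open +-*-Solver
  -- Naming σ and π costs `2ℓn` in the exponent and the chain gains `k(n − 2k)`, so `k` has to
  -- exceed `2ℓ`.
  k = 3 * ℓ
  S = count isSimple (allMatrices n)
  twinned = λ M → any (λ l → ⌊ twins? l M ⌋) (allVecs (2 + k * 2) (allFin n))
  moved = λ M → any (λ l → ⌊ moved? d k l M ⌋) (allVecs 2 (allVecs n (allFin n)))
  ℓ≤ℓ² : ℓ ≤ ℓ * ℓ
  ℓ≤ℓ² = ≤-trans (≤-reflexive (sym (*-identityʳ ℓ))) (*-monoʳ-≤ ℓ 1≤ℓ)
  1≤ℓ² : 1 ≤ ℓ * ℓ
  1≤ℓ² = ≤-trans 1≤ℓ ℓ≤ℓ²
  twinned-bound : 2 ^ t * count twinned (allMatrices n) ≤ S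
  twinned-bound = cancel-2^ t (ℓ * (2 + k * 2)) (n ∸ (2 + k * 2)) exponents
    (≤-trans (union-bound (2 ^ (n ∸ (2 + k * 2))) S (allVecs (2 + k * 2) (allFin n)) _ (allMatrices n) twins-count)
      (*-monoˡ-≤ S labels))
    where
    labels : length (allVecs (2 + k * 2) (allFin n)) ≤ 2 ^ (ℓ * (2 + k * 2))
    labels = begin
      length (allVecs (2 + k * 2) (allFin n)) ≡⟨ length-allVecs (allFin n) (2 + k * 2) ⟩
      length (allFin n) ^ (2 + k * 2)         ≡⟨ cong (_^ (2 + k * 2)) (length-allFin n) ⟩
      n ^ (2 + k * 2)                         ≤⟨ ^-monoˡ-≤ (2 + k * 2) n≤2^ℓ ⟩
      (2 ^ ℓ) ^ (2 + k * 2)                   ≡⟨ ^-*-assoc 2 ℓ (2 + k * 2) ⟩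
      2 ^ (ℓ * (2 + k * 2))                   ∎
    exponents : t + ℓ * (2 + k * 2) ≤ n ∸ (2 + k * 2)
    exponents = m+n≤o⇒m≤o∸n _ (begin
      t + ℓ * (2 + k * 2) + (2 + k * 2)
        ≡⟨ solve 2 (λ t ℓ → t :+ ℓ :* (con 2 :+ con 3 :* ℓ :* con 2) :+ (con 2 :+ con 3 :* ℓ :* con 2)
                         := t :+ con 6 :* (ℓ :* ℓ) :+ con 8 :* ℓ :+ con 2 :* con 1) refl t ℓ ⟩
      t + 6 * (ℓ * ℓ) + 8 * ℓ + 2 * 1
        ≤⟨ +-mono-≤ (+-monoʳ-≤ (t + 6 * (ℓ * ℓ)) (*-monoʳ-≤ 8 ℓ≤ℓ²)) (*-monoʳ-≤ 2 1≤ℓ²) ⟩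
      t + 6 * (ℓ * ℓ) + 8 * (ℓ * ℓ) + 2 * (ℓ * ℓ)
        ≡⟨ solve 2 (λ t s → t :+ con 6 :* s :+ con 8 :* s :+ con 2 :* s := t :+ con 16 :* s) refl t (ℓ * ℓ) ⟩
      t + 16 * (ℓ * ℓ)  ≤⟨ +-monoʳ-≤ t (*-monoˡ-≤ (ℓ * ℓ) (m≤m+n 16 2)) ⟩
      t + 18 * (ℓ * ℓ)  ≤⟨ big ⟩
      n                 ∎)
  moved-bound : 2 ^ t * count moved (allMatrices n) ≤ S
  moved-bound = cancel-2^ t (ℓ * n * 2) (k * (n ∸ k * 2)) exponents
    (≤-trans (union-bound (2 ^ (k * (n ∸ k * 2))) S (allVecs 2 (allVecs n (allFin n))) _ (allMatrices n) (moved-count d k))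
      (*-monoˡ-≤ S labels))
    where
    labels : length (allVecs 2 (allVecs n (allFin n))) ≤ 2 ^ (ℓ * n * 2)
    labels = begin
      length (allVecs 2 (allVecs n (allFin n))) ≡⟨ length-allVecs (allVecs n (allFin n)) 2 ⟩
      length (allVecs n (allFin n)) ^ 2         ≡⟨ cong (_^ 2) (length-allVecs (allFin n) n) ⟩
      (length (allFin n) ^ n) ^ 2               ≡⟨ cong (λ m → (m ^ n) ^ 2) (length-allFin n) ⟩
      (n ^ n) ^ 2                               ≤⟨ ^-monoˡ-≤ 2 (^-monoˡ-≤ n n≤2^ℓ) ⟩
      ((2 ^ ℓ) ^ n) ^ 2                         ≡⟨ cong (_^ 2) (^-*-assoc 2 ℓ n) ⟩
      (2 ^ (ℓ * n)) ^ 2                         ≡⟨ ^-*-assoc 2 (ℓ * n) 2 ⟩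
      2 ^ (ℓ * n * 2)                           ∎
    m = n ∸ k * 2
    18ℓ≤n : t + 18 * ℓ ≤ n
    18ℓ≤n = ≤-trans (+-monoʳ-≤ t (*-monoʳ-≤ 18 ℓ≤ℓ²)) big
    t+12ℓ≤m : t + 12 * ℓ ≤ m
    t+12ℓ≤m = m+n≤o⇒m≤o∸n _ (≤-trans
      (≤-reflexive (solve 2 (λ t ℓ → t :+ con 12 :* ℓ :+ con 3 :* ℓ :* con 2 := t :+ con 18 :* ℓ) refl t ℓ))
      18ℓ≤n)
    n≡ : n ≡ m + k * 2
    n≡ = sym (m∸n+n≡m (≤-trans (≤-trans (≤-reflexive (solve 1 (λ ℓ → con 3 :* ℓ :* con 2 := con 6 :* ℓ) refl ℓ))
      (*-monoˡ-≤ ℓ (m≤m+n 6 12))) (m+n≤o⇒n≤o t 18ℓ≤n)))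
    -- Substituting `n = m + 6ℓ` leaves `t + 12ℓ² ≤ ℓm`, which is `t+12ℓ≤m` multiplied by `ℓ`, as
    -- `t ≤ ℓt`.
    exponents : t + ℓ * n * 2 ≤ k * m
    exponents = begin
      t + ℓ * n * 2                       ≡⟨ cong (λ n → t + ℓ * n * 2) n≡ ⟩
      t + ℓ * (m + k * 2) * 2             ≤⟨ +-monoˡ-≤ _ (≤-trans (≤-reflexive (sym (*-identityˡ t))) (*-monoˡ-≤ t 1≤ℓ)) ⟩
      ℓ * t + ℓ * (m + k * 2) * 2
        ≡⟨ solve 3 (λ t ℓ m → ℓ :* t :+ ℓ :* (m :+ con 3 :* ℓ :* con 2) :* con 2
                           := ℓ :* (t :+ con 12 :* ℓ) :+ con 2 :* ℓ :* m) refl t ℓ m ⟩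
      ℓ * (t + 12 * ℓ) + 2 * ℓ * m        ≤⟨ +-monoˡ-≤ _ (*-monoʳ-≤ ℓ t+12ℓ≤m) ⟩
      ℓ * m + 2 * ℓ * m                   ≡⟨ solve 2 (λ ℓ m → ℓ :* m :+ con 2 :* ℓ :* m := con 3 :* ℓ :* m) refl ℓ m ⟩
      k * m                               ∎

-- Logarithms against powers of two

binary-length : ∀ n → 1 ≤ n → ∃ λ ℓ → 2 ^ ℓ ≤ n × n < 2 ^ suc ℓ
binary-length (suc zero)    _ = 0 , s≤s z≤n , s≤s (s≤s z≤n)
binary-length (suc n@(suc _)) _ with binary-length n (s≤s z≤n)
... | ℓ , lo , hi with suc n <? 2 ^ suc ℓ
...   | yes sn< = ℓ , m≤n⇒m≤1+n lo , sn<
...   | no sn≮  = suc ℓ , ≮⇒≥ sn≮ , (begin-strict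
  suc n                     ≤⟨ hi ⟩
  2 ^ suc ℓ                 <⟨ ^-monoʳ-< 2 (s≤s (s≤s z≤n)) (n<1+n (suc ℓ)) ⟩
  2 ^ suc (suc ℓ)           ∎)
  where open ≤-Reasoning

-- The induction starts at 36 · 15² = 8100 ≤ 16384 = 2¹⁴; from 15 on, passing to the next square at
-- most doubles it.
quadratic≤exponential : ∀ j → 36 * ((j + 15) * (j + 15)) ≤ 2 ^ (j + 14)
quadratic≤exponential zero    = toWitness {a? = 36 * (15 * 15) ≤? 2 ^ 14} _
quadratic≤exponential (suc j) = begin
  -- The added term is the slack 2(j + 15)² - (j + 16)².
  36 * (suc m * suc m)                            ≤⟨ *-monoʳ-≤ 36 (m≤m+n (suc m * suc m) (194 + 28 * j + j * j)) ⟩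
  36 * (suc m * suc m + (194 + 28 * j + j * j))   ≡⟨ solve 1 (λ j →
    con 36 :* ((con 1 :+ (j :+ con 15)) :* (con 1 :+ (j :+ con 15)) :+ (con 194 :+ con 28 :* j :+ j :* j))
    := con 2 :* (con 36 :* ((j :+ con 15) :* (j :+ con 15)))) refl j ⟩
  2 * (36 * (m * m))                              ≤⟨ *-monoʳ-≤ 2 (quadratic≤exponential j) ⟩
  2 ^ (suc j + 14)                                ∎
  where
  open ≤-Reasoning
  open +-*-Solver
  m = j + 15

-- The witness is one more than the rounded-down logarithm, so `n` lies below `2 ^ ℓ` but only
-- `2 ^ (ℓ − 1)` is known to lie below `n`; hence the shift between 15 and 14 in
-- `quadratic≤exponential`.
log-bound : ∀ n → 2 ^ 14 ≤ n → ∃ λ ℓ → 1 ≤ ℓ × n ≤ 2 ^ ℓ × 36 * (ℓ * ℓ) ≤ n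
log-bound n 2¹⁴≤n with binary-length n (≤-trans (m^n>0 2 14) 2¹⁴≤n)
... | ℓ , lo , hi = suc ℓ , s≤s z≤n , <⇒≤ hi , (begin
  36 * (suc ℓ * suc ℓ)             ≡⟨ cong (λ i → 36 * (i * i)) (trans (cong suc (sym ℓ≡)) (sym (+-suc j 14))) ⟩
  36 * ((j + 15) * (j + 15))       ≤⟨ quadratic≤exponential j ⟩
  2 ^ (j + 14)                     ≡⟨ cong (2 ^_) ℓ≡ ⟩
  2 ^ ℓ                            ≤⟨ lo ⟩
  n                                ∎)
  where
  open ≤-Reasoning
  j = ℓ ∸ 14
  14≤ℓ : 14 ≤ ℓ
  14≤ℓ = ≮⇒≥ (λ ℓ<14 → <⇒≱ hi (≤-trans (^-monoʳ-≤ 2 ℓ<14) 2¹⁴≤n))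
  ℓ≡ : j + 14 ≡ ℓ
  ℓ≡ = m∸n+n≡m 14≤ℓ

-- Passing to the limit

n≤2^n : ∀ n → n ≤ 2 ^ n
n≤2^n zero    = z≤n
n≤2^n (suc n) = ≤-trans (+-mono-≤ (m^n>0 2 n) (n≤2^n n)) (≤-reflexive (cong (2 ^ n +_) (sym (+-identityʳ _))))

-- Each summand takes at most half of `n`, which is where 36 = 2 · 18 comes from.
halve-sum : ∀ t s {n} → 2 * t ≤ n → 36 * s ≤ n → t + 18 * s ≤ n
halve-sum t s {n} 2t≤n 36s≤n = *-cancelˡ-≤ 2 (begin
  2 * (t + 18 * s)    ≡⟨ solve 2 (λ t s → con 2 :* (t :+ con 18 :* s) := con 2 :* t :+ con 36 :* s) refl t s ⟩
  2 * t + 36 * s      ≤⟨ +-mono-≤ 2t≤n 36s≤n ⟩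
  n + n               ≡⟨ cong (n +_) (+-identityʳ n) ⟨
  2 * n               ∎)
  where
  open ≤-Reasoning
  open +-*-Solver

-- The factor `2 ^ q` absorbs `q`. Of the remaining 4, one factor 2 cancels the 2 on the right and
-- the other makes the inequality strict.
ratio-bound : ∀ p q b S → 0 < p → 0 < S → 2 ^ (2 + q) * b ≤ 2 * S → q * b < p * S
ratio-bound p q b S 0<p 0<S le = *-cancelˡ-< 4 _ _ (begin-strict
  4 * (q * b)               ≤⟨ *-monoʳ-≤ 4 (*-monoˡ-≤ b (n≤2^n q)) ⟩
  4 * (2 ^ q * b)           ≡⟨ solve 2 (λ a b → con 4 :* (a :* b) := con 2 :* (con 2 :* a) :* b) refl (2 ^ q) b ⟩
  2 ^ (2 + q) * b           ≤⟨ le ⟩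
  2 * S                     <⟨ *-monoˡ-< S {{>-nonZero 0<S}} {2} {4} (s≤s (s≤s (s≤s z≤n))) ⟩
  4 * S                     ≤⟨ *-monoʳ-≤ 4 (m≤n*m S p {{>-nonZero 0<p}}) ⟩
  4 * (p * S)               ∎)
  where
  open ≤-Reasoning
  open +-*-Solver

-- The summand `N` of the threshold allows `log-bound`; the summand `2 * (2 + q)` is what
-- `halve-sum` asks for with `t = 2 + q`.
ratio-vanishes : ∀ p q N → 0 < p →
  (∀ n → N ≤ n → ∃ λ ℓ → 1 ≤ ℓ × n ≤ 2 ^ ℓ × 36 * (ℓ * ℓ) ≤ n) →
  ∀ n → 1 ≤ n → N + 2 * (2 + q) ≤ n → q * #nontrivial n < p * #graphs n
ratio-vanishes p q N 0<p log-bound n 1≤n N≤n with log-bound n (m+n≤o⇒m≤o N N≤n)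
... | ℓ , 1≤ℓ , n≤2^ℓ , 36ℓ²≤n =
  ratio-bound p q (#nontrivial n) (#graphs n) 0<p (#graphs>0 {n})
    (nontrivial-bound (2 + q) ℓ (fromℕ< 1≤n) 1≤ℓ n≤2^ℓ
      (halve-sum (2 + q) (ℓ * ℓ) (m+n≤o⇒n≤o N N≤n) 36ℓ²≤n))

-- The fraction p/q plays the part of ε; with denominators cleared, the inequality says that the
-- probability is below ε.
theorem6p4 : (p q : ℕ) → 0 < p → 0 < q →
    ∃ λ N → (n : ℕ) → 1 ≤ n → N ≤ n → q * #nontrivial n < p * #graphs n
theorem6p4 p q 0<p _ = 2 ^ 14 + 2 * (2 + q) , ratio-vanishes p q (2 ^ 14) 0<p log-bound
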